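{- Addition is first-order definable in the structure $\langle\mathbb{Z},\cdot,\leqslant\rangle$. Explicitly, for all $x,y,z\in\mathbb{Z}$, $$x+y=z \iff \big[z=0\wedge \mathsf{S}(x)\cdot\mathsf{S}(y)=\mathsf{S}(x\cdot y)\big]\;\vee\;\big[z\neq 0\wedge \mathsf{S}(z\cdot x)\cdot\mathsf{S}(z\cdot y)=\mathsf{S}(z\cdot z\cdot\mathsf{S}(x\cdot y))\big],$$ where the right-hand side is a formula over $\langle\mathbb{Z},\cdot,\leqslant\rangle$, the successor function $\mathsf{S}$ being definable from the order by $\mathsf{S}(u)=v\iff\forall w\,[u<w\leftrightarrow v\leqslant w]$.
   Context: $\langle\mathbb{Z},\cdot,\leqslant\rangle$ is the first-order structure whose domain is the set of integers, with the usual multiplication and the usual (non-strict) order. "Addition is definable" means that the ternary relation $\{(x,y,z)\in\mathbb{Z}^3 : x+y=z\}$ is defined by a first-order formula (without parameters) in the language $\{\cdot,\leqslant\}$. $\mathsf{S}(u)$ denotes the successor $u+1$ of the integer $u$, and $u<v$ abbreviates $u\leqslant v\wedge u\neq v$. -}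

module Defs where

open import Data.Empty using (⊥)
open import Data.Fin using (Fin; zero; suc; #_)
open import Data.Integer using (ℤ)
import Data.Integer as ℤ
open import Data.Nat using (ℕ)
import Data.Nat as ℕ
open import Data.Product using (_×_; Σ-syntax)
open import Data.Sum using (_⊎_)
open import Data.Vec using (Vec; []; _∷_; lookup)
open import Function using (_∘_)
open import Function.Bundles using (_⇔_)
open import Relation.Binary.PropositionalEquality using (_≡_)

infix  4 _⊨_
infixr 1 _⟺_
infixr 2 _⟹_
infixr 3 _⋎_
infixr 4 _⋏_
infix  5 ∼_
infix  6 _≐_ _≼_ _≺_ _≐ˢ_
infixl 7 _·_ _·ˢ_

-- First-order logic with equality over the language {·, ≤}. Variables are de
-- Bruijn indices: a `Formula n` has its free variables among 0, …, n-1, and a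
-- quantifier binds variable 0, shifting the others up. There are no constants,
-- so formulas carry no parameters.

data Term (n : ℕ) : Set where
  var : Fin n → Term n
  _·_ : Term n → Term n → Term n

data Formula (n : ℕ) : Set where
  _≐_ _≼_         : Term n → Term n → Formula n
  ⊥′              : Formula n
  _⋏_ _⋎_ _⟹_     : Formula n → Formula n → Formula n
  All Ex          : Formula (ℕ.suc n) → Formula n

∼_ : ∀ {n} → Formula n → Formula n
∼ φ = φ ⟹ ⊥′

_⟺_ : ∀ {n} → Formula n → Formula n → Formula n
φ ⟺ ψ = (φ ⟹ ψ) ⋏ (ψ ⟹ φ)

_≺_ : ∀ {n} → Term n → Term n → Formula n
s ≺ t = s ≼ t ⋏ ∼ (s ≐ t)

-- Tarskian satisfaction in ⟨ℤ, ·, ≤⟩, read constructively: under excluded middle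
-- it is the usual satisfaction relation, with → for implication, Σ for ∃ and ⊎ for ∨.

⟦_⟧ : ∀ {n} → Term n → Vec ℤ n → ℤ
⟦ var i ⟧ ρ = lookup ρ i
⟦ s · t ⟧ ρ = ⟦ s ⟧ ρ ℤ.* ⟦ t ⟧ ρ

_⊨_ : ∀ {n} → Vec ℤ n → Formula n → Set
ρ ⊨ s ≐ t   = ⟦ s ⟧ ρ ≡ ⟦ t ⟧ ρ
ρ ⊨ s ≼ t   = ⟦ s ⟧ ρ ℤ.≤ ⟦ t ⟧ ρ
ρ ⊨ ⊥′      = ⊥
ρ ⊨ (φ ⋏ ψ) = (ρ ⊨ φ) × (ρ ⊨ ψ)
ρ ⊨ (φ ⋎ ψ) = (ρ ⊨ φ) ⊎ (ρ ⊨ ψ)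
ρ ⊨ (φ ⟹ ψ) = ρ ⊨ φ → ρ ⊨ ψ
ρ ⊨ All φ   = ∀ (a : ℤ) → (a ∷ ρ) ⊨ φ
ρ ⊨ Ex φ    = Σ[ a ∈ ℤ ] ((a ∷ ρ) ⊨ φ)

Definable₃ : (ℤ → ℤ → ℤ → Set) → Set
Definable₃ R =
  Σ[ φ ∈ Formula 3 ] (∀ x y z → R x y z ⇔ (x ∷ y ∷ z ∷ [] ⊨ φ))

-- S(u) = v, as ∀w [u < w ↔ v ≤ w].
succGraph : ∀ {n} → Fin n → Fin n → Formula n
succGraph u v = All ((var (suc u) ≺ w) ⟺ (var (suc v) ≼ w))
  where w = var zero

-- v = 0, as ∀w [v·w = v].
isZero : ∀ {n} → Fin n → Formula n
isZero v = All (var (suc v) · var zero ≐ var (suc v))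

-- Terms that also use S and 0. They are not part of the language: `graph`
-- eliminates the defined symbols in favour of the formulas above.
data STerm (n : ℕ) : Set where
  varˢ : Fin n → STerm n
  _·ˢ_ : STerm n → STerm n → STerm n
  S    : STerm n → STerm n
  𝟎    : STerm n

-- `graph t r v` expresses "t = v", each variable i of t being read as r i;
-- the subterms of t are named by fresh existentially bound variables.
graph : ∀ {n m} → STerm n → (Fin n → Fin m) → Fin m → Formula m
graph (varˢ i) r v = var (r i) ≐ var v
graph (s ·ˢ t) r v =
  Ex (Ex (graph s (suc ∘ suc ∘ r) (# 1)
        ⋏ graph t (suc ∘ suc ∘ r) (# 0)
        ⋏ var (# 1) · var (# 0) ≐ var (suc (suc v))))
graph (S t)    r v = Ex (graph t (suc ∘ r) zero ⋏ succGraph zero (suc v))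
graph 𝟎        r v = isZero v

_≐ˢ_ : ∀ {n} → STerm n → STerm n → Formula n
s ≐ˢ t = Ex (graph s suc zero ⋏ graph t suc zero)

successorFormula : Formula 2
successorFormula = succGraph (# 0) (# 1)

additionFormula : Formula 3
additionFormula =
    (z ≐ˢ 𝟎 ⋏ S x ·ˢ S y ≐ˢ S (x ·ˢ y))
  ⋎ (∼ (z ≐ˢ 𝟎) ⋏ S (z ·ˢ x) ·ˢ S (z ·ˢ y) ≐ˢ S (z ·ˢ z ·ˢ S (x ·ˢ y)))
  where
    x y z : STerm 3
    x = varˢ (# 0)
    y = varˢ (# 1)
    z = varˢ (# 2)

{-# OPTIONS --safe #-}
-- The two sides of the equation for z ≠ 0 expand to
--   1 + z(x + y) + z²xy   and   1 + z² + z²xy,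
-- so it says z(x + y) = z·z, and z can be cancelled. For z = 0 the equation
-- S(x)·S(y) = S(x·y) says x + y = 0.
module Submission where

open import Algebra.Properties.AbelianGroup using (∙-cancelˡ; ∙-cancelʳ)
open import Data.Fin using (Fin; #_)
open import Data.Integer using (ℤ; 0ℤ; 1ℤ; _+_; _*_; suc; _≤_; _<_; ≢-nonZero; _≟_)
open import Data.Integer.Properties
  using ( +-0-abelianGroup; *-zeroʳ; *-cancelˡ-≡; ≤-refl; ≤-reflexive; ≤-trans; ≤-antisym
        ; <⇒≤; <⇒≢; ≤∧≢⇒<; suc[i]≤j⇒i<j; i<j⇒suc[i]≤j)
open import Data.Integer.Tactic.RingSolver using (solve-∀)
open import Data.Product using (_×_; _,_; proj₁; proj₂)
open import Data.Product.Function.NonDependent.Propositional using (_×-⇔_)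
open import Data.Sum using (_⊎_; inj₁; inj₂)
open import Data.Sum.Function.Propositional using (_⊎-⇔_)
open import Data.Vec using (Vec; []; _∷_; lookup)
open import Function using (_∘_)
open import Function.Bundles using (_⇔_; mk⇔; Equivalence)
open import Function.Construct.Composition using (_⇔-∘_)
open import Function.Related.TypeIsomorphisms using (¬-cong-⇔)
open import Relation.Binary.PropositionalEquality
  using (_≡_; _≢_; refl; sym; trans; cong; cong₂; subst)
open import Relation.Nullary using (yes; no)
open import Defs

open Equivalence using (to; from)

-- The intended value of a term with `S` and `𝟎`, against which the elimination of these symbols by
-- `graph` is checked.
evalˢ : ∀ {n} → STerm n → (Fin n → ℤ) → ℤ
evalˢ (varˢ i) σ = σ i
evalˢ (s ·ˢ t) σ = evalˢ s σ * evalˢ t σ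
evalˢ (S t)    σ = suc (evalˢ t σ)
evalˢ 𝟎        σ = 0ℤ

≺⇔< : ∀ {n} {ρ : Vec ℤ n} (s t : Term n) → (ρ ⊨ s ≺ t) ⇔ (⟦ s ⟧ ρ < ⟦ t ⟧ ρ)
≺⇔< s t = mk⇔ (λ (s≤t , s≢t) → ≤∧≢⇒< s≤t s≢t) (λ s<t → <⇒≤ s<t , <⇒≢ s<t)

-- The order of ℤ is discrete: u < w means u + 1 ≤ w. So the formula says that u + 1 and v have the
-- same upper bounds.
succGraph-⇔ : ∀ {n} (u v : Fin n) (ρ : Vec ℤ n) →
              (suc (lookup ρ u) ≡ lookup ρ v) ⇔ (ρ ⊨ succGraph u v)
succGraph-⇔ u v ρ = mk⇔
  (λ eq w →
      (λ u≺w → subst (_≤ w) eq (i<j⇒suc[i]≤j (to (lt w) u≺w)))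
    , (λ v≤w → from (lt w) (suc[i]≤j⇒i<j (≤-trans (≤-reflexive eq) v≤w))))
  -- The instances are w = v, giving u + 1 ≤ v, and w = u + 1, giving v ≤ u + 1.
  (λ h → ≤-antisym
    (i<j⇒suc[i]≤j (to (lt _) (proj₂ (h _) ≤-refl)))
    (proj₁ (h _) (from (lt _) (suc[i]≤j⇒i<j ≤-refl))))
  where
  lt : ∀ w → ((w ∷ ρ) ⊨ var (Fin.suc u) ≺ var Fin.zero) ⇔ (lookup ρ u < w)
  lt w = ≺⇔< {ρ = w ∷ ρ} (var (Fin.suc u)) (var Fin.zero)

-- Structural induction on t. Each bound variable of `graph` is forced to equal the value of the
-- subterm it names, and that value is also the witness for it.
graph-⇔ : ∀ {n m} (t : STerm n) (r : Fin n → Fin m) (v : Fin m) (ρ : Vec ℤ m) →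
          (ρ ⊨ graph t r v) ⇔ (evalˢ t (lookup ρ ∘ r) ≡ lookup ρ v)
graph-⇔ (varˢ i) r v ρ = mk⇔ (λ eq → eq) (λ eq → eq)
graph-⇔ (s ·ˢ t) r v ρ = mk⇔
  (λ (a , b , s≡a , t≡b , ab≡v) →
    trans (cong₂ _*_ (to (graph-⇔ s _ _ _) s≡a) (to (graph-⇔ t _ _ _) t≡b)) ab≡v)
  (λ eq → _ , _ , from (graph-⇔ s _ _ _) refl , from (graph-⇔ t _ _ _) refl , eq)
graph-⇔ (S t) r v ρ = mk⇔
  (λ (a , t≡a , Sa≡v) →
    trans (cong suc (to (graph-⇔ t _ _ _) t≡a)) (from (succGraph-⇔ Fin.zero (Fin.suc v) (a ∷ ρ)) Sa≡v))
  (λ eq → _ , from (graph-⇔ t _ _ _) refl , to (succGraph-⇔ Fin.zero (Fin.suc v) (_ ∷ ρ)) eq)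
graph-⇔ 𝟎 r v ρ = mk⇔
  -- The instance w = 0 suffices: v = v · 0 = 0.
  (λ h → trans (sym (*-zeroʳ (lookup ρ v))) (h 0ℤ))
  (λ eq w → subst (λ i → i * w ≡ i) eq refl)

≐ˢ-⇔ : ∀ {n} (s t : STerm n) (ρ : Vec ℤ n) →
       (evalˢ s (lookup ρ) ≡ evalˢ t (lookup ρ)) ⇔ (ρ ⊨ s ≐ˢ t)
≐ˢ-⇔ s t ρ = mk⇔
  (λ eq → _ , from (graph-⇔ s _ _ _) eq , from (graph-⇔ t _ _ _) refl)
  (λ (_ , s≡a , t≡a) → trans (to (graph-⇔ s _ _ _) s≡a) (sym (to (graph-⇔ t _ _ _) t≡a)))

-- The hypothesis says a - b = d - c, so both differences vanish together. This reduces each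
-- equivalence below to one polynomial identity, which the ring solver proves.
+-balance : ∀ a b {c d} → a + c ≡ b + d → (a ≡ b) ⇔ (c ≡ d)
+-balance a b {c} {d} eq = mk⇔
  (λ a≡b → ∙-cancelˡ +-0-abelianGroup b c d (subst (λ i → i + c ≡ b + d) a≡b eq))
  (λ c≡d → ∙-cancelʳ +-0-abelianGroup d a b (subst (λ i → a + i ≡ b + d) c≡d eq))

suc-*-suc : ∀ x y → (suc x * suc y ≡ suc (x * y)) ⇔ (0ℤ ≡ x + y)
suc-*-suc x y = +-balance (suc x * suc y) (suc (x * y)) (expand x y)
  where
  expand : ∀ x y → (1ℤ + x) * (1ℤ + y) + 0ℤ ≡ 1ℤ + x * y + (x + y)
  expand = solve-∀

suc-*-suc-scaled : ∀ x y z →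
  (suc (z * x) * suc (z * y) ≡ suc (z * z * suc (x * y))) ⇔ (z * z ≡ z * (x + y))
suc-*-suc-scaled x y z =
  +-balance (suc (z * x) * suc (z * y)) (suc (z * z * suc (x * y))) (expand x y z)
  where
  expand : ∀ x y z → (1ℤ + z * x) * (1ℤ + z * y) + z * z
                   ≡ 1ℤ + z * z * (1ℤ + x * y) + z * (x + y)
  expand = solve-∀

-- The case split cannot be avoided with these equations: at z = 0 the scaled one reads 1 = 1 for
-- all x and y.
+-via-suc-* : ∀ x y z →
  (x + y ≡ z) ⇔ ( (z ≡ 0ℤ × suc x * suc y ≡ suc (x * y))
                ⊎ (z ≢ 0ℤ × suc (z * x) * suc (z * y) ≡ suc (z * z * suc (x * y))))
+-via-suc-* x y z = mk⇔ ⇒ ⇐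
  where
  ⇒ : x + y ≡ z → _
  -- Equality on ℤ is decidable, so the disjunct is chosen constructively.
  ⇒ eq with z ≟ 0ℤ
  ... | yes z≡0 = inj₁ (z≡0 , from (suc-*-suc x y) (sym (trans eq z≡0)))
  ... | no  z≢0 = inj₂ (z≢0 , from (suc-*-suc-scaled x y z) (cong (z *_) (sym eq)))

  ⇐ : _ → x + y ≡ z
  ⇐ (inj₁ (z≡0 , h)) = sym (trans z≡0 (to (suc-*-suc x y) h))
  ⇐ (inj₂ (z≢0 , h)) =
    sym (*-cancelˡ-≡ z z (x + y) {{≢-nonZero z≢0}} (to (suc-*-suc-scaled x y z) h))

-- Satisfaction unfolds to the same connectives as the arithmetical criterion, so only the atomic
-- equations have to be translated.
additionFormula-⇔ : ∀ x y z → (x + y ≡ z) ⇔ (x ∷ y ∷ z ∷ [] ⊨ additionFormula)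
additionFormula-⇔ x y z =
  (   (≐ˢ-⇔ z′ 𝟎 ρ ×-⇔ ≐ˢ-⇔ (S x′ ·ˢ S y′) (S (x′ ·ˢ y′)) ρ)
  ⊎-⇔ (¬-cong-⇔ (≐ˢ-⇔ z′ 𝟎 ρ)
    ×-⇔ ≐ˢ-⇔ (S (z′ ·ˢ x′) ·ˢ S (z′ ·ˢ y′)) (S (z′ ·ˢ z′ ·ˢ S (x′ ·ˢ y′))) ρ))
  ⇔-∘ +-via-suc-* x y z
  where
  ρ = x ∷ y ∷ z ∷ []

  x′ y′ z′ : STerm 3
  x′ = varˢ (# 0)
  y′ = varˢ (# 1)
  z′ = varˢ (# 2)

mainTheorem1 : Definable₃ (λ x y z → x + y ≡ z)
    × (∀ (x y z : ℤ) → (x + y ≡ z) ⇔ ((z ≡ 0ℤ × suc x * suc y ≡ suc (x * y)) ⊎ (z ≢ 0ℤ × suc (z * x) * suc (z * y) ≡ suc (z * z * suc (x * y)))))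
    × (∀ (x y z : ℤ) → (x + y ≡ z) ⇔ (x ∷ y ∷ z ∷ [] ⊨ additionFormula))
    × (∀ (u v : ℤ) → (suc u ≡ v) ⇔ (u ∷ v ∷ [] ⊨ successorFormula))
mainTheorem1 =
    (additionFormula , additionFormula-⇔)
  , +-via-suc-*
  , additionFormula-⇔
  , (λ u v → succGraph-⇔ (# 0) (# 1) (u ∷ v ∷ []))
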